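{- $\textsc{Evil Hangman}$ is undecidable when the language $L$ is the language defined by an arbitrary Turing machine: that is, the problem, given a Turing machine $T$ with input alphabet $\Sigma$, a word length $k$ and an integer $d$, of deciding whether $(L(T)\cap\Sigma^k,d)$ is a positive instance of $\textsc{Evil Hangman}$ is undecidable.
   Context: $L(T)$ is the set of words accepted by $T$. The game is played over the language of the machine projected to words of length $k$, i.e. over $L=L(T)\cap\Sigma^k$. $\textsc{Evil Hangman}$ for a finite language $L\subseteq\Sigma^k$ and integer $d$: decide whether a cheating setter can play the following game so that no guesser can get the secret word without making at least $d$ failed guesses. Both players know $L$. A state consists of a mask $M$ (a word of length $k$ over $\Sigma\cup\{\bot\}$, where $\bot\notin\Sigma$ marks a position not yet revealed) and the set $S\subseteq\Sigma$ of symbols not yet guessed. Initially $M=\bot^k$, $S=\Sigma$. In each turn the guesser picks $s\in S$; the setter chooses a (possibly empty) set $B$ of positions with $M_j=\bot$ and replaces $\bot$ by $s$ exactly at the positions in $B$, giving a new mask $M'$, subject to the requirement that there be $w\in L$ with $w_j=M'_j$ whenever $M'_j\ne\bot$ and $w_j\in S\setminus\{s\}$ whenever $M'_j=\bot$. Then $S$ is replaced by $S\setminus\{s\}$. The guess is failed if $B=\varnothing$. The word is fully revealed when the mask contains no $\bot$. $(L,d)$ is positive if $L\neq\varnothing$ and the setter has a strategy such that, against every (adaptive) guesser, at least $d$ failed guesses are made before the word is fully revealed; otherwise it is negative. -}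

module Defs where

open import Data.Bool.Base using (if_then_else_)
open import Data.Fin.Base using (Fin; zero; suc; toℕ; _↑ˡ_)
open import Data.Fin.Patterns using (0F; 1F)
open import Data.Fin.Subset using (Subset; _∈_; _-_; ⊤; Nonempty)
open import Data.Fin.Subset.Properties using (nonempty?)
open import Data.Integer.Base using (ℤ; +_; -[1+_]; _≤_)
open import Data.List.Base as List using (List; []; _∷_; _++_; allFin; concatMap)
open import Data.Maybe.Base using (Maybe; just; nothing)
open import Data.Nat.Base using (ℕ; zero; suc; _+_)
open import Data.Product.Base using (∃; _×_; _,_; proj₁)
open import Data.Vec.Base using (Vec; lookup; replicate; toList; zipWith)
open import Level using (0ℓ)
open import Relation.Binary.Construct.Closure.ReflexiveTransitive using (Star)
open import Relation.Binary.PropositionalEquality.Core using (_≡_; _≢_)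
open import Relation.Nullary.Decidable.Core using (does)
open import Relation.Nullary.Negation.Core using (¬_)
open import Relation.Unary using (Pred; Satisfiable)

------------------------------------------------------------------------
-- Turing machines

data Direction : Set where
  left right : Direction

-- Deterministic one-tape machines with input alphabet Fin σ. The tape
-- alphabet consists of the blank, the σ input symbols and `extra` further
-- symbols, in this order. The values of δ at accept and reject are never used.
record TM (σ : ℕ) : Set where
  field
    extra states : ℕ

  Symbol : Set
  Symbol = Fin (suc (σ + extra))

  State : Set
  State = Fin states

  field
    start accept reject : State
    accept≢reject       : accept ≢ reject
    δ                   : State → Symbol → State × Symbol × Direction

module Run {σ : ℕ} (T : TM σ) where

  open TM T

  blank : Symbol
  blank = zero

  input : Fin σ → Symbol
  input a = suc (a ↑ˡ extra)

  -- The tape is infinite in both directions: the two lists hold the cells to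
  -- the left and to the right of the head, nearest first, and all cells beyond
  -- them are blank.
  record Config : Set where
    constructor config
    field
      state  : State
      before : List Symbol
      head   : Symbol
      after  : List Symbol

  move : Direction → State → List Symbol → Symbol → List Symbol → Config
  move left  q []       a rs       = config q [] blank (a ∷ rs)
  move left  q (l ∷ ls) a rs       = config q ls l (a ∷ rs)
  move right q ls       a []       = config q (a ∷ ls) blank []
  move right q ls       a (r ∷ rs) = config q (a ∷ ls) r rs

  next : Config → Config
  next (config q ls a rs) =
    let (q′ , a′ , dir) = δ q a in move dir q′ ls a′ rs

  infix 4 _⟶_ _⟶*_

  record _⟶_ (c c′ : Config) : Set where
    field
      not-accepted : Config.state c ≢ accept
      not-rejected : Config.state c ≢ reject
      moves        : next c ≡ c′

  _⟶*_ : Config → Config → Set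
  _⟶*_ = Star _⟶_

  initial : List (Fin σ) → Config
  initial []      = config start [] blank []
  initial (a ∷ w) = config start [] (input a) (List.map input w)

  HaltsIn : State → List (Fin σ) → Set
  HaltsIn q w = ∃ λ c → initial w ⟶* c × Config.state c ≡ q

  Accepts Rejects : List (Fin σ) → Set
  Accepts = HaltsIn accept
  Rejects = HaltsIn reject

-- L(T) ∩ Σᵏ
language : ∀ {σ} → TM σ → (k : ℕ) → Pred (Vec (Fin σ) k) 0ℓ
language T k w = Run.Accepts T (toList w)

------------------------------------------------------------------------
-- Undecidability of a problem on A whose instances are presented to a machine
-- as binary words

Word₂ : Set
Word₂ = List (Fin 2)

-- Nothing is required of D on words that are not encodings of instances.
Decides : {A : Set} → TM 2 → (A → Word₂) → Pred A 0ℓ → Set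
Decides D encode P = ∀ x →
  (P x → Run.Accepts D (encode x)) × (¬ P x → Run.Rejects D (encode x))

Undecidable : {A : Set} → (A → Word₂) → Pred A 0ℓ → Set
Undecidable encode P = ¬ (∃ λ D → Decides D encode P)

------------------------------------------------------------------------
-- The game

module Game (σ k : ℕ) where

  -- nothing marks a position that is not yet revealed.
  Mask : Set
  Mask = Vec (Maybe (Fin σ)) k

  record State : Set where
    constructor ⟨_,_⟩
    field
      mask      : Mask
      unguessed : Subset σ
  open State public

  initial : State
  initial = ⟨ replicate k nothing , ⊤ ⟩

  -- A guess together with the set of positions the setter reveals for it.
  Turn : Set
  Turn = Fin σ × Subset k

  reveal : Fin σ → Subset k → Mask → Mask
  reveal s = zipWith (λ b m → if b then just s else m)

  update : Turn → State → State
  update (s , B) ⟨ M , S ⟩ = ⟨ reveal s B M , S - s ⟩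

  -- Most recent turn first.
  History : Set
  History = List Turn

  stateAfter : History → State
  stateAfter = List.foldr update initial

  Revealed : Mask → Set
  Revealed M = ∀ j → lookup M j ≢ nothing

  Consistent : State → Pred (Vec (Fin σ) k) 0ℓ
  Consistent ⟨ M , S ⟩ w =
      (∀ j a → lookup M j ≡ just a → lookup w j ≡ a)
    × (∀ j → lookup M j ≡ nothing → lookup w j ∈ S)

  record Legal (L : Pred (Vec (Fin σ) k) 0ℓ) (st : State) (s : Fin σ)
               (B : Subset k) : Set where
    field
      on-blanks : ∀ {j} → j ∈ B → lookup (mask st) j ≡ nothing
      possible  : ∃ λ w → L w × Consistent (update (s , B) st) w

  failures : History → ℕ
  failures []            = 0
  failures ((_ , B) ∷ h) =
    if does (nonempty? B) then failures h else suc (failures h)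

  Setter : Set
  Setter = History → Fin σ → Subset k

  Guesser : Set
  Guesser = (h : History) → Nonempty (unguessed (stateAfter h)) →
            ∃ λ s → s ∈ unguessed (stateAfter h)

  -- The histories that arise, up to the moment when the word is fully
  -- revealed, when τ plays against γ.
  data Play (τ : Setter) (γ : Guesser) : History → Set where
    begin : Play τ γ []
    turn  : ∀ {h} → Play τ γ h → ¬ Revealed (mask (stateAfter h)) →
            (ne : Nonempty (unguessed (stateAfter h))) →
            let s = proj₁ (γ h ne) in Play τ γ ((s , τ h s) ∷ h)

  -- A legal play lasts at most σ turns: once all symbols have been guessed,
  -- Consistent leaves no unrevealed position. Hence every play reaches the
  -- situation that `delays` speaks about.
  record Forces (L : Pred (Vec (Fin σ) k) 0ℓ) (d : ℤ) (τ : Setter)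
                (γ : Guesser) : Set where
    field
      legal  : ∀ {s B h} → Play τ γ ((s , B) ∷ h) → Legal L (stateAfter h) s B
      delays : ∀ {h} → Play τ γ h → Revealed (mask (stateAfter h)) →
               d ≤ + failures h

EvilHangman : ∀ {σ k} → Pred (Vec (Fin σ) k) 0ℓ → ℤ → Set
EvilHangman {σ} {k} L d =
  Satisfiable L × (∃ λ τ → ∀ γ → Game.Forces σ k L d τ γ)

------------------------------------------------------------------------
-- Instances given by a Turing machine

record Instance : Set where
  field
    {σ}     : ℕ
    machine : TM σ
    k       : ℕ
    d       : ℤ

Positive : Pred Instance 0ℓ
Positive x = EvilHangman (language machine k) d
  where open Instance x

-- All codes are self-delimiting, so they can be concatenated without
-- separators; the length of the transition table is determined by the numbers
-- preceding it.
encodeℕ : ℕ → Word₂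
encodeℕ zero    = 0F ∷ []
encodeℕ (suc n) = 1F ∷ encodeℕ n

encodeℤ : ℤ → Word₂
encodeℤ (+ n)    = 0F ∷ encodeℕ n
encodeℤ -[1+ n ] = 1F ∷ encodeℕ n

encodeFin : ∀ {n} → Fin n → Word₂
encodeFin i = encodeℕ (toℕ i)

encodeDirection : Direction → Word₂
encodeDirection left  = 0F ∷ []
encodeDirection right = 1F ∷ []

encodeTM : ∀ {σ} → TM σ → Word₂
encodeTM {σ} T =
  encodeℕ σ ++ encodeℕ extra ++ encodeℕ states ++
  encodeFin start ++ encodeFin accept ++ encodeFin reject ++
  concatMap (λ q → concatMap (λ a → encodeRule (δ q a)) (allFin _)) (allFin _)
  where
  open TM T
  encodeRule : State × Symbol × Direction → Word₂
  encodeRule (q , a , dir) = encodeFin q ++ encodeFin a ++ encodeDirection dir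

encodeInstance : Instance → Word₂
encodeInstance x = encodeTM machine ++ encodeℕ k ++ encodeℤ d
  where open Instance x

{-# OPTIONS --safe #-}

-- Over a one-letter alphabet and with d = 0, the instance (T , k , 0) is
-- positive exactly when T accepts 1ᵏ. A decider D would therefore yield a
-- machine X which on input 1ⁿ⁺¹ writes down the n-th binary word u, runs D on
-- u followed by the codes of n + 1 and 0, and answers the opposite. Choosing n
-- such that u encodes X itself makes X accept 1ⁿ⁺¹ iff it does not.
--
-- X obtains u by counting in bijective base 2 (digits 1 and 2 written as 0 and
-- 1), for which every word is the numeral of some n.

module Submission where

open import Defs
open import Data.Fin.Base using (Fin; zero; suc; _↑ʳ_)
open import Data.Fin.Patterns
open import Data.Fin.Properties using (↑ʳ-injective)
open import Data.Fin.Subset using () renaming (⊤ to full)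
open import Data.Integer.Base using (+_; +≤+)
open import Data.List.Base using (List; []; _∷_; _++_; _ʳ++_; map; replicate; reverse)
open import Data.List.Properties using (map-replicate; ʳ++-ʳ++)
open import Data.Maybe.Base using (just; nothing)
open import Data.Maybe.Properties using (just-injective)
open import Data.Nat.Base using (ℕ; zero; suc; _+_; z≤n)
open import Data.Nat.Properties using (+-suc; +-identityʳ)
open import Data.Product.Base using (∃; _×_; _,_; map₁)
open import Data.Vec.Base as Vec using (Vec; []; _∷_; toList; lookup)
open import Data.Vec.Properties using (lookup-replicate)
open import Function.Base using (_∘_)
open import Relation.Binary.Construct.Closure.ReflexiveTransitive using (ε; _◅_; _◅◅_)
open import Relation.Binary.PropositionalEquality
open import Relation.Nullary.Negation.Core using (¬_; contradiction)

-- Determinism and single head moves of Turing machines.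

module Machine {σ} (T : TM σ) where

  open TM T public
  open Run T public

  ⟶-functional : ∀ {c c₁ c₂} → c ⟶ c₁ → c ⟶ c₂ → c₁ ≡ c₂
  ⟶-functional s t = trans (sym (_⟶_.moves s)) (_⟶_.moves t)

  -- By determinism the two runs agree step by step until one of them ends, and no step leaves a
  -- halting state.
  halting-state-unique : ∀ {c c₁ c₂} → c ⟶* c₁ → Config.state c₁ ≡ accept →
                         c ⟶* c₂ → Config.state c₂ ≢ reject
  halting-state-unique ε        p ε        q = accept≢reject (trans (sym p) q)
  halting-state-unique ε        p (s ◅ _)  q = _⟶_.not-accepted s p
  halting-state-unique (s ◅ _)  p ε        q = _⟶_.not-rejected s q
  halting-state-unique (s ◅ ss) p (t ◅ ts) q with refl ← ⟶-functional s t =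
    halting-state-unique ss p ts q

  accepts⇒¬rejects : ∀ {w} → Accepts w → ¬ Rejects w
  accepts⇒¬rejects (_ , ss , p) (_ , ts , q) = halting-state-unique ss p ts q

  -- These absorb the case split of `move` at the end of the recorded tape, so that sweeps can be
  -- stated for arbitrary lists.
  scanʳ scanˡ : State → List Symbol → List Symbol → Config
  scanʳ q ls []       = config q ls blank []
  scanʳ q ls (r ∷ rs) = config q ls r rs
  scanˡ q []       rs = config q [] blank rs
  scanˡ q (l ∷ ls) rs = config q ls l rs

  rightward : ∀ {q a q′ a′ ls rs} → q ≢ accept → q ≢ reject →
              δ q a ≡ (q′ , a′ , right) →
              config q ls a rs ⟶ scanʳ q′ (a′ ∷ ls) rs
  rightward ≢acc ≢rej eq = record
    { not-accepted = ≢acc ; not-rejected = ≢rej ; moves = lemma eq }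
    where
    lemma : ∀ {q a q′ a′ ls rs} → δ q a ≡ (q′ , a′ , right) →
            next (config q ls a rs) ≡ scanʳ q′ (a′ ∷ ls) rs
    lemma {rs = []}    eq rewrite eq = refl
    lemma {rs = _ ∷ _} eq rewrite eq = refl

  leftward : ∀ {q a q′ a′ ls rs} → q ≢ accept → q ≢ reject →
             δ q a ≡ (q′ , a′ , left) →
             config q ls a rs ⟶ scanˡ q′ ls (a′ ∷ rs)
  leftward ≢acc ≢rej eq = record
    { not-accepted = ≢acc ; not-rejected = ≢rej ; moves = lemma eq }
    where
    lemma : ∀ {q a q′ a′ ls rs} → δ q a ≡ (q′ , a′ , left) →
            next (config q ls a rs) ≡ scanˡ q′ ls (a′ ∷ rs)
    lemma {ls = []}    eq rewrite eq = refl
    lemma {ls = _ ∷ _} eq rewrite eq = refl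

-- Bijective base-2 numerals.

-- Least significant digit first.
increment : Word₂ → Word₂
increment []       = 0F ∷ []
increment (0F ∷ u) = 1F ∷ u
increment (1F ∷ u) = 0F ∷ increment u

-- Accumulator form, matching the counting loop in `count-all`.
increments : ℕ → Word₂ → Word₂
increments zero    u = u
increments (suc n) u = increments n (increment u)

numeral : ℕ → Word₂
numeral zero    = []
numeral (suc n) = increment (numeral n)

increments-numeral : ∀ n m → increments n (numeral m) ≡ numeral (n + m)
increments-numeral zero    m = refl
increments-numeral (suc n) m =
  trans (increments-numeral n (suc m)) (cong numeral (+-suc n m))

-- The witness is 2n + 1, as `0F` is the digit 1. Two increments lead from `0F ∷ u` through `1F ∷ u`
-- to `0F ∷ increment u`.
numeral-0∷ : ∀ n → ∃ λ m → numeral m ≡ 0F ∷ numeral n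
numeral-0∷ zero    = 1 , refl
numeral-0∷ (suc n) with m , eq ← numeral-0∷ n =
  suc (suc m) , cong (increment ∘ increment) eq

numeral-surjective : ∀ u → ∃ λ n → numeral n ≡ u
numeral-surjective []      = 0 , refl
numeral-surjective (b ∷ u) with numeral-surjective u
... | n , refl with b | numeral-0∷ n
...   | 0F | m , eq = m , eq
...   | 1F | m , eq = suc m , cong increment eq

unary-word : ∀ {k} (w : Vec (Fin 1) k) → toList w ≡ replicate k 0F
unary-word []       = refl
unary-word (0F ∷ w) = cong (0F ∷_) (unary-word w)

-- The game over a one-letter alphabet.

module OneLetterGame (k : ℕ) where

  open Game 1 k

  lookup-reveal : ∀ (M : Vec _ k) j → lookup (reveal 0F full M) j ≡ just 0F
  lookup-reveal = go
    where
    go : ∀ {n} (M : Vec _ n) j → lookup (Game.reveal 1 n 0F full M) j ≡ just 0F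
    go (_ ∷ _) 0F      = refl
    go (_ ∷ M) (suc j) = go M j

  lookup-unary : ∀ {n} (w : Vec (Fin 1) n) j → 0F ≡ lookup w j
  lookup-unary w j with 0F ← lookup w j = refl

  reveal-all : Setter
  reveal-all _ _ = full

  reveal-all-revealed : ∀ s M → ¬ ¬ Revealed (reveal s full M)
  reveal-all-revealed 0F M ¬r =
    ¬r λ j eq → contradiction (trans (sym (lookup-reveal M j)) eq) λ ()

  -- The first guess reveals the whole mask, so no play has a second turn and legality matters for
  -- the first one only.
  reveal-all-forces : ∀ {L} → ∃ L → ∀ γ → Forces L (+ 0) reveal-all γ
  reveal-all-forces {L} (w , w∈L) γ = record
    { legal = legal ; delays = λ _ _ → +≤+ z≤n }
    where
    first-turn : ∀ s → Legal L initial s full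
    first-turn 0F = record
      { on-blanks = λ {j} _ → lookup-replicate j nothing
      ; possible  = w , w∈L
                  , (λ j a eq → trans (sym (lookup-unary w j))
                      (just-injective (trans (sym (lookup-reveal (mask initial) j)) eq)))
                  , (λ j eq → contradiction
                      (trans (sym (lookup-reveal (mask initial) j)) eq) λ ())
      }

    legal : ∀ {s B h} → Play reveal-all γ ((s , B) ∷ h) → Legal L (stateAfter h) s B
    legal (turn begin _ _) = first-turn _
    legal (turn (turn {h} _ _ _) ¬r _) =
      contradiction ¬r (reveal-all-revealed _ (mask (stateAfter h)))

-- The diagonal machine.

module Diagonal (D : TM 2) where

  private module D = Machine D

  -- D's letters 0 and 1; X has the same tape alphabet, and its input letter is a.
  pattern a = suc zero
  pattern b = suc (suc zero)
  pattern simulated q =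
    suc (suc (suc (suc (suc (suc (suc (suc (suc q))))))))

  simulate : D.State × D.Symbol × Direction → Fin (9 + D.states) × D.Symbol × Direction
  simulate = map₁ (9 ↑ʳ_)

  -- The tape holds the counter, a blank, and then the input, whose letters are
  -- turned from a into b as they are counted. State 1 looks for the next a,
  -- 2 returns to the blank, 3 increments the counter, 4 returns to the blank.
  -- Without a further a, states 5 and 6 append the remaining zeros, and 7
  -- and 8 go back to the left end. The first letter of the input is sacrificed
  -- for the blank, which becomes b in state 7, so the counter ends up one short
  -- of the length of the input.
  transition : Fin (9 + D.states) → D.Symbol → Fin (9 + D.states) × D.Symbol × Direction
  transition 0F _ = 1F , zero , right
  transition 1F b = 1F , b , right
  transition 1F a = 2F , b , left
  transition 1F _ = 5F , a , right
  transition 2F b = 2F , b , left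
  transition 2F _ = 3F , zero , left
  transition 3F b = 3F , a , left
  transition 3F a = 4F , b , right
  transition 3F _ = 4F , a , right
  transition 4F zero = 1F , zero , right
  transition 4F s    = 4F , s , right
  transition 5F _ = 6F , a , right
  transition 6F _ = 7F , a , left
  transition 7F zero = 8F , b , left
  transition 7F s    = 7F , s , left
  transition 8F zero = 9 ↑ʳ D.start , zero , right
  transition 8F s    = 8F , s , left
  transition (simulated q) s = simulate (D.δ q s)

  X : TM 1
  X = record
    -- The additional symbol makes up for the missing input letter, so both tape alphabets agree
    -- definitionally.
    { extra         = suc D.extra
    ; states        = 9 + D.states
    ; start         = 0F
    ; accept        = 9 ↑ʳ D.reject
    ; reject        = 9 ↑ʳ D.accept
    ; accept≢reject = D.accept≢reject ∘ sym ∘ ↑ʳ-injective 9 _ _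
    ; δ             = transition
    }

  open Machine X

  -- X enters D's start state with a visited blank to the left of the head, where
  -- D's tape has nothing recorded.
  embed : ℕ → D.Config → Config
  embed m (D.config q ls s rs) = config (9 ↑ʳ q) (ls ++ replicate m blank) s rs

  -- A left move beyond the cells recorded for `D` uses up one surplus blank if there is one; all
  -- other moves keep `m`.
  embed-move : ∀ m dir q ls s rs → ∃ λ m′ →
               move dir (9 ↑ʳ q) (ls ++ replicate m blank) s rs ≡
               embed m′ (D.move dir q ls s rs)
  embed-move zero    left  q []      s rs      = zero , refl
  embed-move (suc m) left  q []      s rs      = m , refl
  embed-move m       left  q (_ ∷ _) s rs      = m , refl
  embed-move m       right q ls      s []      = m , refl
  embed-move m       right q ls      s (_ ∷ _) = m , refl

  simulate-step : ∀ m {c c′} → c D.⟶ c′ → ∃ λ m′ → embed m c ⟶ embed m′ c′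
  simulate-step m {D.config q ls s rs} st
    with q′ , s′ , dir ← D.δ q s in eq
    with m′ , eq′ ← embed-move m dir q′ ls s′ rs
    = m′ , record
    { not-accepted = D._⟶_.not-rejected st ∘ ↑ʳ-injective 9 _ _
    ; not-rejected = D._⟶_.not-accepted st ∘ ↑ʳ-injective 9 _ _
    ; moves        = trans moves′ (trans eq′ (cong (embed m′) (trans (sym moves″) (D._⟶_.moves st))))
    }
    where
    moves′ : next (embed m (D.config q ls s rs)) ≡
             move dir (9 ↑ʳ q′) (ls ++ replicate m blank) s′ rs
    moves′ rewrite eq = refl
    moves″ : D.next (D.config q ls s rs) ≡ D.move dir q′ ls s′ rs
    moves″ rewrite eq = refl

  simulate-run : ∀ m {c c′} → c D.⟶* c′ → ∃ λ m′ → embed m c ⟶* embed m′ c′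
  simulate-run m ε        = m , ε
  simulate-run m (s ◅ ss) with m₁ , t  ← simulate-step m s
                          with m₂ , ts ← simulate-run m₁ ss = m₂ , t ◅ ts

  -- The least significant digit is nearest to the head. On `1F` the carry moves on to the left, and
  -- the final step is state 4 coming back over the `a` left behind.
  count : ∀ u rs → scanˡ 3F (map D.input u) rs ⟶* scanʳ 4F (map D.input (increment u)) rs
  count []       rs = rightward (λ ()) (λ ()) refl ◅ ε
  count (0F ∷ u) rs = rightward (λ ()) (λ ()) refl ◅ ε
  count (1F ∷ u) rs =
    leftward (λ ()) (λ ()) refl ◅ count u (a ∷ rs) ◅◅ rightward (λ ()) (λ ()) refl ◅ ε

  -- Each `b` is crossed once outward in state 1 and once back in state 2, around the round trip for
  -- the shorter block.
  mark : ∀ i ls rs → scanʳ 1F ls (replicate i b ++ a ∷ rs) ⟶*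
                     scanˡ 2F ls (replicate i b ++ b ∷ rs)
  mark zero    ls rs = leftward (λ ()) (λ ()) refl ◅ ε
  mark (suc i) ls rs =
    rightward (λ ()) (λ ()) refl ◅ mark i (b ∷ ls) rs ◅◅ leftward (λ ()) (λ ()) refl ◅ ε

  replicate-++-∷ : ∀ {A : Set} i (x : A) ys → replicate i x ++ x ∷ ys ≡ x ∷ replicate i x ++ ys
  replicate-++-∷ zero    x ys = refl
  replicate-++-∷ (suc i) x ys = cong (x ∷_) (replicate-++-∷ i x ys)

  -- Loop invariant: `i` letters are counted, `j` are not yet, and `u` is the counter.
  count-all : ∀ i j u → scanʳ 1F (blank ∷ map D.input u) (replicate i b ++ replicate j a) ⟶*
                        scanʳ 1F (blank ∷ map D.input (increments j u)) (replicate (j + i) b ++ [])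
  count-all i zero    u = ε
  count-all i (suc j) u =
    mark i (blank ∷ map D.input u) (replicate j a) ◅◅
    leftward (λ ()) (λ ()) refl ◅
    count u _ ◅◅
    rightward (λ ()) (λ ()) refl ◅
    -- The letter just marked joins the block of counted ones.
    subst₂ (λ xs n → scanʳ 1F ls xs ⟶* scanʳ 1F ls′ (replicate n b ++ []))
      (sym (replicate-++-∷ i b (replicate j a))) (+-suc j i) (count-all (suc i) j (increment u))
    where
    ls ls′ : List Symbol
    ls  = blank ∷ map D.input (increment u)
    ls′ = blank ∷ map D.input (increments j (increment u))

  -- The marked letters already are the ones of `encodeℕ i`. Of the three zeros written in states 1,
  -- 5 and 6, the first ends this code and the others form `encodeℤ (+ 0)`.
  append-zeros : ∀ i ls → scanʳ 1F ls (replicate i b ++ []) ⟶*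
                          scanˡ 7F ls (map D.input (encodeℕ i ++ encodeℤ (+ 0)))
  append-zeros zero ls =
    rightward (λ ()) (λ ()) refl ◅ rightward (λ ()) (λ ()) refl ◅
    leftward (λ ()) (λ ()) refl ◅ leftward (λ ()) (λ ()) refl ◅ leftward (λ ()) (λ ()) refl ◅ ε
  append-zeros (suc i) ls =
    rightward (λ ()) (λ ()) refl ◅ append-zeros i (b ∷ ls) ◅◅ leftward (λ ()) (λ ()) refl ◅ ε

  -- The counter has its least significant digit on the right, so read from the left it is reversed;
  -- hence the `reverse` in the choice of `n`.
  rewind : ∀ u v → scanˡ 8F (map D.input u) (map D.input v) ⟶* scanˡ 8F [] (map D.input (u ʳ++ v))
  rewind []       v = ε
  rewind (0F ∷ u) v = leftward (λ ()) (λ ()) refl ◅ rewind u (0F ∷ v)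
  rewind (1F ∷ u) v = leftward (λ ()) (λ ()) refl ◅ rewind u (1F ∷ v)

  scanʳ-start : ∀ u → scanʳ (9 ↑ʳ D.start) (blank ∷ []) (map D.input u) ≡ embed 1 (D.initial u)
  scanʳ-start []      = refl
  scanʳ-start (_ ∷ _) = refl

  run-numeral : ∀ n → initial (replicate (suc n) 0F) ⟶*
                embed 1 (D.initial (numeral n ʳ++ encodeℕ (suc n) ++ encodeℤ (+ 0)))
  run-numeral n =
    rightward (λ ()) (λ ()) refl ◅
    subst₂ (λ xs c → scanʳ 1F (blank ∷ []) xs ⟶* c)
      (sym (map-replicate input n 0F))
      (cong₂ (λ u i → scanʳ 1F (blank ∷ map D.input u) (replicate i b ++ []))
        (trans (increments-numeral n 0) (cong numeral (+-identityʳ n))) (+-identityʳ n))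
      (count-all 0 n []) ◅◅
    append-zeros n _ ◅◅
    -- The separating blank becomes the additional one that turns `encodeℕ n` into
    -- `encodeℕ (suc n)`.
    leftward (λ ()) (λ ()) refl ◅
    rewind (numeral n) (encodeℕ (suc n) ++ encodeℤ (+ 0)) ◅◅
    rightward (λ ()) (λ ()) refl ◅
    subst (scanʳ (9 ↑ʳ D.start) (blank ∷ []) (map D.input u) ⟶*_) (scanʳ-start u) ε
    where
    u : Word₂
    u = numeral n ʳ++ encodeℕ (suc n) ++ encodeℤ (+ 0)

  -- The instance describing `X` itself.

  module _ (n : ℕ) (n-encodes-X : numeral n ≡ reverse (encodeTM X)) where

    self : Instance
    self = record { machine = X ; k = suc n ; d = + 0 }

    run-self : initial (replicate (suc n) 0F) ⟶* embed 1 (D.initial (encodeInstance self))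
    run-self = subst (λ v → initial (replicate (suc n) 0F) ⟶* embed 1 (D.initial v)) eq
                     (run-numeral n)
      where
      eq : numeral n ʳ++ encodeℕ (suc n) ++ encodeℤ (+ 0) ≡ encodeInstance self
      eq = trans (cong (_ʳ++ _) n-encodes-X) (ʳ++-ʳ++ (encodeTM X))

    run-halting : ∀ {q} → D.HaltsIn q (encodeInstance self) →
                  HaltsIn (9 ↑ʳ q) (replicate (suc n) 0F)
    run-halting (_ , ss , p) with m , ts ← simulate-run 1 ss =
      _ , run-self ◅◅ ts , cong (9 ↑ʳ_) p

    positive⇒accepts : Positive self → Accepts (replicate (suc n) 0F)
    positive⇒accepts ((w , w∈L) , _) = subst Accepts (unary-word w) w∈L

    accepts⇒positive : Accepts (replicate (suc n) 0F) → Positive self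
    accepts⇒positive acc = w∈L , reveal-all , reveal-all-forces w∈L
      where
      open OneLetterGame (suc n)
      w∈L : ∃ (language X (suc n))
      w∈L = Vec.replicate (suc n) 0F ,
            subst Accepts (sym (unary-word (Vec.replicate (suc n) 0F))) acc

    not-decided : ¬ Decides D encodeInstance Positive
    not-decided decides with yes⇒ , no⇒ ← decides self =
      -- Refuting `Positive self` first makes `no⇒` applicable without excluded middle.
      negative (accepts⇒positive (run-halting (no⇒ negative)))
      where
      negative : ¬ Positive self
      negative pos = accepts⇒¬rejects {replicate (suc n) 0F}
                       (positive⇒accepts pos) (run-halting (yes⇒ pos))

theorem15 : Undecidable encodeInstance Positive
theorem15 (D , decides) =
  let open Diagonal D
      n , n-encodes-X = numeral-surjective (reverse (encodeTM X))
  in not-decided n n-encodes-X decides
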